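{- Let $X$ be a set of cardinality at least $2^{\aleph_0}$, regarded as a discrete topological space. Then for every formula $A$ of $\mathcal{L}_\nabla$: (i) if $X\vDash_{i\mathbf{ST}}A$ then $i\mathbf{STL}\vdash\,\Rightarrow A$; (ii) if $X\vDash_{i\mathbf{ST}(F)}A$ then $i\mathbf{STL}(F)\vdash\,\Rightarrow A$; (iii) if $X\vDash_{i\mathbf{ST}(wF)}A$ then $i\mathbf{STL}(wF)\vdash\,\Rightarrow A$.
   Context: Language $\mathcal{L}_\nabla$: formulas from atoms and constants $\top,\bot,1$ by $\wedge,\vee,\otimes,\to$ and unary $\nabla$; sequents $\Gamma\Rightarrow A$, $\Gamma$ a finite sequence, $\nabla\Gamma$ applying $\nabla$ to each member. $\mathbf{STL}$: axioms $A\Rightarrow A$; $\Rightarrow1$; $\nabla1\Rightarrow1$; $\Gamma\Rightarrow\top$; $\Gamma,\bot,\Sigma\Rightarrow A$; cut (from $\Gamma\Rightarrow A$, $\Pi,A,\Sigma\Rightarrow B$ infer $\Pi,\Gamma,\Sigma\Rightarrow B$); $L\wedge$ (from $\Gamma,A,\Sigma\Rightarrow C$ infer $\Gamma,A\wedge B,\Sigma\Rightarrow C$ and $\Gamma,B\wedge A,\Sigma\Rightarrow C$); $R\wedge$ (from $\Gamma\Rightarrow A$, $\Gamma\Rightarrow B$ infer $\Gamma\Rightarrow A\wedge B$); $L\vee$ (from $\Gamma,A,\Sigma\Rightarrow C$, $\Gamma,B,\Sigma\Rightarrow C$ infer $\Gamma,A\vee B,\Sigma\Rightarrow C$); $R\vee$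 (from $\Gamma\Rightarrow A$ infer $\Gamma\Rightarrow A\vee B$ and $\Gamma\Rightarrow B\vee A$); $L1$ (from $\Gamma,\Sigma\Rightarrow A$ infer $\Gamma,1,\Sigma\Rightarrow A$); $L\otimes$ (from $\Gamma,A,B,\Sigma\Rightarrow C$ infer $\Gamma,A\otimes B,\Sigma\Rightarrow C$); $R\otimes$ (from $\Gamma\Rightarrow A$, $\Sigma\Rightarrow B$ infer $\Gamma,\Sigma\Rightarrow A\otimes B$); $\nabla$ (from $A\Rightarrow B$ infer $\nabla A\Rightarrow\nabla B$); Oplax (from $\nabla A,\nabla B\Rightarrow C$ infer $\nabla(A\otimes B)\Rightarrow C$); $L\to$ (from $\Gamma\Rightarrow A$ and $\Pi,B,\Sigma\Rightarrow C$ infer $\Pi,\Gamma,\nabla(A\to B),\Sigma\Rightarrow C$); $R\to$ (from $A,\nabla\Gamma\Rightarrow B$ infer $\Gamma\Rightarrow A\to B$). $(F)$: from $\Gamma\Rightarrow A$ infer $\Gamma\Rightarrow\nabla A$. $(wF)$: from $\nabla A\Rightarrow\bot$ infer $A\Rightarrow\bot$. $i\mathbf{STL}$ is $\mathbf{STL}$ plus left weakening, contraction and exchange; $i\mathbf{STL}(F)$, $i\mathbf{STL}(wF)$ add the respective scheme. Semantics: for the discrete space $X$, opens are all subsets; a spacetime on it is a join ($\cup$) preserving $\nabla:\mathcal{P}(X)\to\mathcal{P}(X)$, with implication $\to_\nabla$ defined by $a\cap\nabla b\subseteq c$ iff $b\subseteq a\to_\nabla c$. A valuation $U$ maps atoms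 to subsets, extended by $U(1)=U(\top)=X$, $U(\bot)=\emptyset$, $U(A\wedge B)=U(A\otimes B)=U(A)\cap U(B)$, $U(A\vee B)=U(A)\cup U(B)$, $U(\nabla A)=\nabla U(A)$, $U(A\to B)=U(A)\to_\nabla U(B)$. $i\mathbf{ST}$ is the class of all such spacetimes; $i\mathbf{ST}(F)$ those with $a\subseteq\nabla a$ for all $a$; $i\mathbf{ST}(wF)$ those with $\nabla a=\emptyset\Rightarrow a=\emptyset$. $X\vDash_{\mathcal{C}}A$ means $U(A)=X$ for every $\nabla$ with $(\mathcal{P}(X),\nabla)\in\mathcal{C}$ and every valuation $U$. -}

module Defs where

open import Data.Nat using (ℕ)
open import Data.Bool using (Bool)
open import Data.List using (List; []; _∷_; _++_; [_]; map)
open import Data.Product using (Σ; _×_)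
open import Data.Empty using (⊥)
open import Relation.Binary.PropositionalEquality using (_≡_)

infixr 6 _∧_ _∨_ _⊗_
infixr 5 _⇒_

data Fm : Set where
  atom          : ℕ → Fm
  ⊤ᶠ ⊥ᶠ 𝟏       : Fm
  _∧_ _∨_ _⊗_ _⇒_ : Fm → Fm → Fm
  ∇ᶠ            : Fm → Fm

Ctx : Set
Ctx = List Fm

data Logic : Set where
  base withF withwF : Logic

variable
  L : Logic
  Γ Π Δ : Ctx
  A B C : Fm

data _⊢[_]_ : Ctx → Logic → Fm → Set where
  ax    : [ A ] ⊢[ L ] A
  one   : [] ⊢[ L ] 𝟏
  ∇one  : [ ∇ᶠ 𝟏 ] ⊢[ L ] 𝟏
  top   : Γ ⊢[ L ] ⊤ᶠ
  bot   : (Γ ++ ⊥ᶠ ∷ Δ) ⊢[ L ] A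
  cut   : Γ ⊢[ L ] A → (Π ++ A ∷ Δ) ⊢[ L ] B → (Π ++ Γ ++ Δ) ⊢[ L ] B
  L∧₁   : (Γ ++ A ∷ Δ) ⊢[ L ] C → (Γ ++ (A ∧ B) ∷ Δ) ⊢[ L ] C
  L∧₂   : (Γ ++ A ∷ Δ) ⊢[ L ] C → (Γ ++ (B ∧ A) ∷ Δ) ⊢[ L ] C
  R∧    : Γ ⊢[ L ] A → Γ ⊢[ L ] B → Γ ⊢[ L ] (A ∧ B)
  L∨    : (Γ ++ A ∷ Δ) ⊢[ L ] C → (Γ ++ B ∷ Δ) ⊢[ L ] C → (Γ ++ (A ∨ B) ∷ Δ) ⊢[ L ] C
  R∨₁   : Γ ⊢[ L ] A → Γ ⊢[ L ] (A ∨ B)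
  R∨₂   : Γ ⊢[ L ] A → Γ ⊢[ L ] (B ∨ A)
  L1    : (Γ ++ Δ) ⊢[ L ] A → (Γ ++ 𝟏 ∷ Δ) ⊢[ L ] A
  L⊗    : (Γ ++ A ∷ B ∷ Δ) ⊢[ L ] C → (Γ ++ (A ⊗ B) ∷ Δ) ⊢[ L ] C
  R⊗    : Γ ⊢[ L ] A → Δ ⊢[ L ] B → (Γ ++ Δ) ⊢[ L ] (A ⊗ B)
  ∇r    : [ A ] ⊢[ L ] B → [ ∇ᶠ A ] ⊢[ L ] ∇ᶠ B
  oplax : (∇ᶠ A ∷ ∇ᶠ B ∷ []) ⊢[ L ] C → [ ∇ᶠ (A ⊗ B) ] ⊢[ L ] C
  L→    : Γ ⊢[ L ] A → (Π ++ B ∷ Δ) ⊢[ L ] C → (Π ++ Γ ++ ∇ᶠ (A ⇒ B) ∷ Δ) ⊢[ L ] C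
  R→    : (A ∷ map ∇ᶠ Γ) ⊢[ L ] B → Γ ⊢[ L ] (A ⇒ B)
  weak  : (Γ ++ Δ) ⊢[ L ] C → (Γ ++ A ∷ Δ) ⊢[ L ] C
  contr : (Γ ++ A ∷ A ∷ Δ) ⊢[ L ] C → (Γ ++ A ∷ Δ) ⊢[ L ] C
  exch  : (Γ ++ A ∷ B ∷ Δ) ⊢[ L ] C → (Γ ++ B ∷ A ∷ Δ) ⊢[ L ] C
  F     : L ≡ withF → Γ ⊢[ L ] A → Γ ⊢[ L ] ∇ᶠ A
  wF    : L ≡ withwF → [ ∇ᶠ A ] ⊢[ L ] ⊥ᶠ → [ A ] ⊢[ L ] ⊥ᶠ

-- Subsets of X (the opens of the discrete space X), as predicates

Subset : Set → Set₁
Subset X = X → Set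

module _ {X : Set} where
  _⊆_ : Subset X → Subset X → Set
  a ⊆ b = ∀ x → a x → b x

  _≐_ : Subset X → Subset X → Set
  a ≐ b = (a ⊆ b) × (b ⊆ a)

  _∩_ : Subset X → Subset X → Subset X
  (a ∩ b) x = a x × b x

  _∪_ : Subset X → Subset X → Subset X
  (a ∪ b) x = Data.Sum._⊎_ (a x) (b x)
    where import Data.Sum

  ∅ : Subset X
  ∅ x = ⊥

  Full : Subset X
  Full x = Data.Unit.⊤
    where import Data.Unit

  ⋃ : {I : Set} → (I → Subset X) → Subset X
  ⋃ {I} f x = Σ I (λ i → f i x)

-- Spacetimes on the discrete space X: a (arbitrary-)join preserving map ∇
-- on P(X), together with its implication →_∇ characterised by the adjunction
-- a ∩ ∇ b ⊆ c  iff  b ⊆ a →_∇ c  (which determines it uniquely).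

record Spacetime (X : Set) : Set₁ where
  field
    ∇       : Subset X → Subset X
    ∇-cong  : ∀ {a b} → a ≐ b → ∇ a ≐ ∇ b
    ∇-join  : ∀ (I : Set) (f : I → Subset X) → ∇ (⋃ f) ≐ ⋃ (λ i → ∇ (f i))
    _⇛_     : Subset X → Subset X → Subset X
    ⇛-adj   : ∀ a b c → ((a ∩ ∇ b) ⊆ c → b ⊆ (a ⇛ c)) × (b ⊆ (a ⇛ c) → (a ∩ ∇ b) ⊆ c)

open Spacetime public

InClass : {X : Set} → Logic → Spacetime X → Set₁
InClass base    S = Data.Unit.Polymorphic.⊤
  where import Data.Unit.Polymorphic
InClass withF   S = ∀ a → a ⊆ ∇ S a
InClass withwF  S = ∀ a → ∇ S a ≐ ∅ → a ≐ ∅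

Valuation : Set → Set₁
Valuation X = ℕ → Subset X

⟦_⟧ : {X : Set} → Fm → Spacetime X → Valuation X → Subset X
⟦ atom n ⟧ S U = U n
⟦ ⊤ᶠ ⟧     S U = Full
⟦ ⊥ᶠ ⟧     S U = ∅
⟦ 𝟏 ⟧      S U = Full
⟦ A ∧ B ⟧  S U = ⟦ A ⟧ S U ∩ ⟦ B ⟧ S U
⟦ A ⊗ B ⟧  S U = ⟦ A ⟧ S U ∩ ⟦ B ⟧ S U
⟦ A ∨ B ⟧  S U = ⟦ A ⟧ S U ∪ ⟦ B ⟧ S U
⟦ A ⇒ B ⟧  S U = _⇛_ S (⟦ A ⟧ S U) (⟦ B ⟧ S U)
⟦ ∇ᶠ A ⟧   S U = ∇ S (⟦ A ⟧ S U)

_⊨[_]_ : (X : Set) → Logic → Fm → Set₁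
X ⊨[ L ] A = ∀ (S : Spacetime X) → InClass L S → ∀ (U : Valuation X) → Full ⊆ ⟦ A ⟧ S U

-- |X| ≥ 2^ℵ₀ : an injection from Cantor space (ℕ → Bool, pointwise equality) into X
AtLeastContinuum : Set → Set
AtLeastContinuum X =
  Σ ((ℕ → Bool) → X) (λ f → ∀ α β → f α ≡ f β → ∀ n → α n ≡ β n)

{-# OPTIONS --safe #-}
-- Let Φ be the list of subformulas of A.  A world is a sublist w of Φ, and w is
-- refuted when w entails the disjunction of Φ ∖ w.  As in Pratt's elimination
-- procedure, start from all sublists of Φ and delete a world as soon as it is not
-- closed under the connectives, or lacks a witness among the remaining worlds for
-- an implication outside it or a ∇-formula inside it, or violates the frame
-- condition (reflexivity for F, seriality for wF): every deleted world is refuted.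
-- If some remaining world omits A, the remaining worlds form a finite Kripke
-- countermodel, which embeds into X.  Otherwise every sublist of Φ omitting A is
-- refuted, and cutting on all formulas of Φ yields a derivation of A.
module Submission where

open import Defs
open import Data.Bool using (Bool; T)
open import Data.Empty using (⊥)
open import Data.Fin using (Fin; toℕ)
open import Data.Fin.Properties using (toℕ-injective)
open import Data.List using (List; []; _∷_; _++_; [_]; map; length; lookup)
open import Data.List.Membership.Propositional using (_∈_; _∉_)
open import Data.List.Membership.Propositional.Properties using (∈-∃++; ∈-map⁺; ∈-++⁺ˡ; ∈-++⁺ʳ; ∈-++⁻; ∈-lookup)
import Data.List.Membership.DecPropositional as DecMembership
open import Data.List.Properties using (++-assoc)
open import Data.List.Relation.Binary.Permutation.Propositional using (_↭_; refl; prep; swap; trans; ↭-sym)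
open import Data.List.Relation.Binary.Permutation.Propositional.Properties using (shift; ++-comm)
open import Data.List.Relation.Binary.Subset.Propositional using () renaming (_⊆_ to _⊑_)
open import Data.List.Relation.Unary.Any using (here; there; index)
open import Data.List.Relation.Unary.Any.Properties using (lookup-index)
open import Data.Maybe using (Maybe; just; nothing; zipWith) renaming (map to mapᴹ)
open import Data.Nat using (ℕ; suc; _≡ᵇ_)
import Data.Nat.Properties as ℕ
open import Data.Product using (_×_; _,_; proj₁; proj₂; ∃; ∃₂)
open import Data.Sum using (_⊎_; inj₁; inj₂; [_,_]′)
import Data.Product as Product
import Data.Sum as Sum
import Data.Unit as Unit
open import Function using (_∘_; id)
open import Relation.Binary using (DecidableEquality)
open import Relation.Binary.PropositionalEquality using (_≡_; refl; sym; cong; cong₂; subst; _≢_) renaming (trans to ≡-trans)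
open import Relation.Nullary using (Dec; yes; no; contradiction)
open import Relation.Nullary.Decidable using (dec⇒maybe; _×-dec_; _⊎-dec_; ¬?)

-- Formulas

-- `Maybe` in place of `Dec` lets one clause cover all mismatched constructors; `same-refl` then
-- turns `nothing` into a proof of inequality.
same : (A B : Fm) → Maybe (A ≡ B)
same (atom m) (atom n)  = mapᴹ (cong atom) (dec⇒maybe (m ℕ.≟ n))
same ⊤ᶠ       ⊤ᶠ        = just refl
same ⊥ᶠ       ⊥ᶠ        = just refl
same 𝟏        𝟏         = just refl
same (A ∧ B)  (A′ ∧ B′) = zipWith (cong₂ _∧_) (same A A′) (same B B′)
same (A ∨ B)  (A′ ∨ B′) = zipWith (cong₂ _∨_) (same A A′) (same B B′)
same (A ⊗ B)  (A′ ⊗ B′) = zipWith (cong₂ _⊗_) (same A A′) (same B B′)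
same (A ⇒ B)  (A′ ⇒ B′) = zipWith (cong₂ _⇒_) (same A A′) (same B B′)
same (∇ᶠ A)   (∇ᶠ A′)   = mapᴹ (cong ∇ᶠ) (same A A′)
same _        _         = nothing

same-refl : ∀ A → ∃ λ p → same A A ≡ just p
same-refl (atom n) with n ℕ.≟ n
... | yes p = cong atom p , refl
... | no ¬p = contradiction refl ¬p
same-refl ⊤ᶠ = refl , refl
same-refl ⊥ᶠ = refl , refl
same-refl 𝟏  = refl , refl
same-refl (A ∧ B) with same-refl A | same-refl B
... | _ , p | _ , q rewrite p | q = _ , refl
same-refl (A ∨ B) with same-refl A | same-refl B
... | _ , p | _ , q rewrite p | q = _ , refl
same-refl (A ⊗ B) with same-refl A | same-refl B
... | _ , p | _ , q rewrite p | q = _ , refl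
same-refl (A ⇒ B) with same-refl A | same-refl B
... | _ , p | _ , q rewrite p | q = _ , refl
same-refl (∇ᶠ A) with same-refl A
... | _ , p rewrite p = _ , refl

_≟_ : DecidableEquality Fm
A ≟ B with same A B in eq
... | just p  = yes p
... | nothing = no λ { refl → nothing≢just (≡-trans (sym eq) (proj₂ (same-refl A))) }
  where
  nothing≢just : ∀ {p : A ≡ A} → nothing ≡ just p → ⊥
  nothing≢just ()

open DecMembership _≟_ using (_∈?_)

children : Fm → List Fm
children (A ∧ B) = A ∷ B ∷ []
children (A ∨ B) = A ∷ B ∷ []
children (A ⊗ B) = A ∷ B ∷ []
children (A ⇒ B) = A ∷ B ∷ []
children (∇ᶠ A)  = A ∷ []
children _       = []

Closed : List Fm → Set
Closed Φ = ∀ {A} → A ∈ Φ → children A ⊑ Φ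

closed-++ : ∀ {Φ Ψ} → Closed Φ → Closed Ψ → Closed (Φ ++ Ψ)
closed-++ {Φ} c d m n with ∈-++⁻ Φ m
... | inj₁ l = ∈-++⁺ˡ (c l n)
... | inj₂ r = ∈-++⁺ʳ Φ (d r n)

closed-∷ : ∀ {Φ} → children A ⊑ Φ → Closed Φ → Closed (A ∷ Φ)
closed-∷ sub c (here refl) n = there (sub n)
closed-∷ sub c (there m)   n = there (c m n)

mutual
  -- Split from `proper` so that `subs A` is a cons for every `A`, and `A ∈ subs A` is `here refl`
  -- without cases.
  subs : Fm → List Fm
  subs A = A ∷ proper A

  proper : Fm → List Fm
  proper (A ∧ B) = subs A ++ subs B
  proper (A ∨ B) = subs A ++ subs B
  proper (A ⊗ B) = subs A ++ subs B
  proper (A ⇒ B) = subs A ++ subs B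
  proper (∇ᶠ A)  = subs A
  proper _       = []

pair-⊑ : ∀ A B → (A ∷ B ∷ []) ⊑ (subs A ++ subs B)
pair-⊑ A B (here refl)         = here refl
pair-⊑ A B (there (here refl)) = ∈-++⁺ʳ (subs A) (here refl)

closed-[] : Closed []
closed-[] ()

subs-closed : ∀ A → Closed (subs A)
subs-closed (atom n) = closed-∷ (λ ()) closed-[]
subs-closed ⊤ᶠ       = closed-∷ (λ ()) closed-[]
subs-closed ⊥ᶠ       = closed-∷ (λ ()) closed-[]
subs-closed 𝟏        = closed-∷ (λ ()) closed-[]
subs-closed (A ∧ B)  = closed-∷ (pair-⊑ A B) (closed-++ (subs-closed A) (subs-closed B))
subs-closed (A ∨ B)  = closed-∷ (pair-⊑ A B) (closed-++ (subs-closed A) (subs-closed B))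
subs-closed (A ⊗ B)  = closed-∷ (pair-⊑ A B) (closed-++ (subs-closed A) (subs-closed B))
subs-closed (A ⇒ B)  = closed-∷ (pair-⊑ A B) (closed-++ (subs-closed A) (subs-closed B))
subs-closed (∇ᶠ A)   = closed-∷ (λ { (here refl) → here refl }) (subs-closed A)

-- Derivations

-- The induction carries a prefix `Θ` because under `prep` the head has to move out of the way of
-- the remaining permutation.
permute : ∀ Θ → Γ ↭ Δ → (Θ ++ Γ) ⊢[ L ] C → (Θ ++ Δ) ⊢[ L ] C
permute Θ refl d = d
permute {L = L} {C = C} Θ (prep {xs} {ys} x p) d =
  subst (_⊢[ L ] C) (++-assoc Θ [ x ] ys)
    (permute (Θ ++ [ x ]) p (subst (_⊢[ L ] C) (sym (++-assoc Θ [ x ] xs)) d))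
permute {L = L} {C = C} Θ (swap {xs} {ys} x y p) d =
  subst (_⊢[ L ] C) (++-assoc Θ (y ∷ x ∷ []) ys)
    (permute (Θ ++ y ∷ x ∷ []) p
      (subst (_⊢[ L ] C) (sym (++-assoc Θ (y ∷ x ∷ []) xs)) (exch {Γ = Θ} d)))
permute Θ (trans p q) d = permute Θ q (permute Θ p d)

weaken-++ : ∀ Δ → Γ ⊢[ L ] C → (Δ ++ Γ) ⊢[ L ] C
weaken-++ []      d = d
weaken-++ (_ ∷ Δ) d = weak {Γ = []} (weaken-++ Δ d)

-- Each formula of `Γ` has a second copy in `Δ`: bring the two together, contract, and undo the
-- permutation.
absorb : ∀ Γ → Γ ⊑ Δ → (Γ ++ Δ) ⊢[ L ] C → Δ ⊢[ L ] C
absorb []      s d = d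
absorb (A ∷ Γ) s d with ∈-∃++ (s (here refl))
... | Θ , Σ , refl =
  absorb Γ (s ∘ there)
    (permute [] (↭-sym front) (contr {Γ = []} (permute [ A ] front d)))
  where
  front : Γ ++ Θ ++ A ∷ Σ ↭ A ∷ (Γ ++ Θ) ++ Σ
  front = subst (_↭ A ∷ (Γ ++ Θ) ++ Σ) (++-assoc Γ Θ (A ∷ Σ)) (shift A (Γ ++ Θ) Σ)

-- From here on antecedents behave as finite sets.
mono : Γ ⊑ Δ → Γ ⊢[ L ] C → Δ ⊢[ L ] C
mono {Γ} {Δ} s d = absorb Γ s (permute [] (++-comm Δ Γ) (weaken-++ Δ d))

hyp : A ∈ Γ → Γ ⊢[ L ] A
hyp m = mono (λ { (here refl) → m }) ax

under : Γ ⊑ Δ → (A ∷ Γ) ⊑ (A ∷ Δ)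
under s (here p)  = here p
under s (there m) = there (s m)

cut₁ : Γ ⊢[ L ] A → (A ∷ Γ) ⊢[ L ] B → Γ ⊢[ L ] B
cut₁ {Γ} d e = mono ([ id , id ]′ ∘ ∈-++⁻ Γ) (cut {Π = []} d e)

cut* : ∀ Δ → (∀ {A} → A ∈ Δ → Γ ⊢[ L ] A) → Δ ⊢[ L ] C → Γ ⊢[ L ] C
cut* {Γ} Δ ds e = go Δ ds (mono ∈-++⁺ˡ e)
  where
  go : ∀ Δ → (∀ {A} → A ∈ Δ → Γ ⊢[ L ] A) → (Δ ++ Γ) ⊢[ L ] C → Γ ⊢[ L ] C
  go []      ds e = e
  go (A ∷ Δ) ds e = go Δ (ds ∘ there) (cut₁ (weaken-++ Δ (ds (here refl))) e)

∧-elim₁ : Γ ⊢[ L ] (A ∧ B) → Γ ⊢[ L ] A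
∧-elim₁ d = cut* [ _ ] (λ { (here refl) → d }) (L∧₁ {Γ = []} ax)

∧-elim₂ : Γ ⊢[ L ] (A ∧ B) → Γ ⊢[ L ] B
∧-elim₂ d = cut* [ _ ] (λ { (here refl) → d }) (L∧₂ {Γ = []} ax)

⊗-intro : Γ ⊢[ L ] A → Γ ⊢[ L ] B → Γ ⊢[ L ] (A ⊗ B)
⊗-intro {Γ} d e = mono ([ id , id ]′ ∘ ∈-++⁻ Γ) (R⊗ d e)

⊗-elim₁ : Γ ⊢[ L ] (A ⊗ B) → Γ ⊢[ L ] A
⊗-elim₁ d = cut* [ _ ] (λ { (here refl) → d }) (L⊗ {Γ = []} (hyp (here refl)))

⊗-elim₂ : Γ ⊢[ L ] (A ⊗ B) → Γ ⊢[ L ] B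
⊗-elim₂ d = cut* [ _ ] (λ { (here refl) → d }) (L⊗ {Γ = []} (hyp (there (here refl))))

∨-elim : Γ ⊢[ L ] (A ∨ B) → (A ∷ Γ) ⊢[ L ] C → (B ∷ Γ) ⊢[ L ] C → Γ ⊢[ L ] C
∨-elim d e f = cut₁ d (L∨ {Γ = []} e f)

⊥-derive : Γ ⊢[ L ] ⊥ᶠ → Γ ⊢[ L ] C
⊥-derive d = cut₁ d (bot {Γ = []})

-- The counit of the adjunction defining implication, which is why `∇ᶠ` guards the implication.
∇-mp : Γ ⊢[ L ] A → Γ ⊢[ L ] ∇ᶠ (A ⇒ B) → Γ ⊢[ L ] B
∇-mp {A = A} {B = B} d e =
  cut* (A ∷ ∇ᶠ (A ⇒ B) ∷ []) (λ { (here refl) → d ; (there (here refl)) → e })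
    (L→ {Γ = [ A ]} {Π = []} {Δ = []} ax ax)

-- Packs a context into one formula, since `R→` discharges, and `wF` acts on, a single formula.
⋀ : Ctx → Fm
⋀ []      = ⊤ᶠ
⋀ (A ∷ Γ) = A ∧ ⋀ Γ

⋀-intro : ∀ Γ → (∀ {A} → A ∈ Γ → Δ ⊢[ L ] A) → Δ ⊢[ L ] ⋀ Γ
⋀-intro []      ds = top
⋀-intro (A ∷ Γ) ds = R∧ (ds (here refl)) (⋀-intro Γ (ds ∘ there))

⋀-elim : A ∈ Γ → Δ ⊢[ L ] ⋀ Γ → Δ ⊢[ L ] A
⋀-elim (here refl) d = ∧-elim₁ d
⋀-elim (there m)   d = ⋀-elim m (∧-elim₂ d)

-- Refuted worlds

sublists : List Fm → List (List Fm)
sublists []      = [ [] ]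
sublists (A ∷ Φ) = map (A ∷_) (sublists Φ) ++ sublists Φ

-- The entailment "Γ, w entails the disjunction of C and Φ ∖ w", read through
-- its elimination rule, so that no disjunction over Φ ∖ w has to be formed.
Entails : Logic → List Fm → List Fm → Ctx → Fm → Set
Entails L Φ w Γ C = ∀ Γ′ C′ → w ⊑ Γ′ → Γ ⊑ Γ′ →
  (∀ {A} → A ∈ Φ → A ∉ w → (A ∷ Γ′) ⊢[ L ] C′) → (C ∷ Γ′) ⊢[ L ] C′ → Γ′ ⊢[ L ] C′

-- A multi-succedent cut on the head `A`, simulated with one succedent: sublists that skip the head
-- yield `A ∨ C`, and those that take it yield `C` from the added hypothesis `A`.
cut-sublists : ∀ Φ → (∀ {w} → w ∈ sublists Φ → Entails L Φ w Γ C) → Γ ⊢[ L ] C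
cut-sublists [] h = h (here refl) _ _ (λ ()) id (λ ()) (hyp (here refl))
cut-sublists {L = L} {Γ = Γ} {C = C} (A ∷ Φ) h =
  ∨-elim (cut-sublists Φ without) (cut-sublists Φ with-A) (hyp (here refl))
  where
  without : ∀ {w} → w ∈ sublists Φ → Entails L Φ w Γ (A ∨ C)
  without m Γ′ C′ sw sΓ k e =
    h (∈-++⁺ʳ (map (A ∷_) (sublists Φ)) m) Γ′ C′ sw sΓ
      (λ { (here refl) _ → via (R∨₁ (hyp (here refl))) ; (there n) → k n })
      (via (R∨₂ (hyp (here refl))))
    where
    via : (B ∷ Γ′) ⊢[ L ] (A ∨ C) → (B ∷ Γ′) ⊢[ L ] C′
    via d = cut₁ d (mono (under there) e)

  with-A : ∀ {w} → w ∈ sublists Φ → Entails L Φ w (A ∷ Γ) C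
  with-A m Γ′ C′ sw sΓ k e =
    h (∈-++⁺ˡ (∈-map⁺ (A ∷_) m)) Γ′ C′
      (λ { (here refl) → sΓ (here refl) ; (there n) → sw n })
      (sΓ ∘ there)
      (λ { (here refl) q → contradiction (here refl) q ; (there n) q → k n (q ∘ there) })
      e

all-or-some : ∀ {a p q} {X : Set a} {P : X → Set p} {Q : X → Set q} (xs : List X) →
  (∀ {x} → x ∈ xs → P x ⊎ Q x) →
  (∀ {x} → x ∈ xs → P x) ⊎ (∃ λ x → x ∈ xs × Q x)
all-or-some []       f = inj₁ λ ()
all-or-some (x ∷ xs) f with f (here refl) | all-or-some xs (f ∘ there)
... | inj₂ q | _                = inj₂ (x , here refl , q)
... | inj₁ _ | inj₂ (y , m , q) = inj₂ (y , there m , q)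
... | inj₁ p | inj₁ ps          = inj₁ λ { (here refl) → p ; (there m) → ps m }

delete : ∀ {X : Set} {x : X} {xs} → x ∈ xs →
  ∃ λ ys → length xs ≡ suc (length ys) × (∀ {y} → y ∈ xs → y ≡ x ⊎ y ∈ ys)
delete {xs = _ ∷ xs} (here refl) = xs , refl , λ { (here p) → inj₁ p ; (there m) → inj₂ m }
delete {xs = z ∷ xs} (there p) with delete p
... | ys , eq , f = z ∷ ys , cong suc eq , λ
  { (here q) → inj₂ (here q)
  ; (there m) → [ inj₁ , inj₂ ∘ there ]′ (f m) }

-- Pratt elimination on the sublists of a closed list

module Elimination (L : Logic) (Φ : List Fm) (closed : Closed Φ) where

  World : Set
  World = List Fm

  left : ∀ {A B Ψ} → (A ∷ B ∷ Ψ) ⊑ Φ → A ∈ Φ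
  left s = s (here refl)

  right : ∀ {A B Ψ} → (A ∷ B ∷ Ψ) ⊑ Φ → B ∈ Φ
  right s = s (there (here refl))

  -- Like `Entails`, an elimination rule for the disjunction of `Φ ∖ w`; quantifying over `Γ` builds
  -- in weakening.
  Refuted : World → Set
  Refuted w = ∀ Γ C → w ⊑ Γ → (∀ {A} → A ∈ Φ → A ∉ w → (A ∷ Γ) ⊢[ L ] C) → Γ ⊢[ L ] C

  refute : ∀ {w} → w ⊢[ L ] A → A ∈ Φ → A ∉ w → Refuted w
  refute d m n Γ C s k = cut₁ (mono s d) (k m n)

  -- Here `w` precedes `v`: implications are tested at later worlds and `∇ᶠ` looks back to earlier
  -- ones. These are the constraints on every related pair; the existential witnesses are asked for
  -- in `Saturated`.
  Compatible : World → World → Fm → Set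
  Compatible w v (A ⇒ B) = (A ⇒ B) ∈ w → A ∈ v → B ∈ v
  Compatible w v (∇ᶠ A)  = A ∈ w → ∇ᶠ A ∈ v
  Compatible w v _       = Unit.⊤

  Acc : World → World → Set
  Acc w v = ∀ {A} → A ∈ Φ → Compatible w v A

  -- A positive form of the failure of `Acc`, naming a formula of `Φ ∖ v` that the rules force.
  data Conflict (w v : World) : Set where
    imp : ∀ {A B} → B ∈ Φ → (A ⇒ B) ∈ w → A ∈ v → B ∉ v → Conflict w v
    dia : ∀ {A} → ∇ᶠ A ∈ Φ → A ∈ w → ∇ᶠ A ∉ v → Conflict w v

  acc-or-conflict : ∀ w v → Acc w v ⊎ Conflict w v
  acc-or-conflict w v with all-or-some Φ check
    where
    check : ∀ {A} → A ∈ Φ → Compatible w v A ⊎ Conflict w v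
    check {A ⇒ B} m with (A ⇒ B) ∈? w | A ∈? v | B ∈? v
    ... | no q  | _     | _     = inj₁ λ p → contradiction p q
    ... | yes _ | no q  | _     = inj₁ λ _ p → contradiction p q
    ... | yes _ | yes _ | yes r = inj₁ λ _ _ → r
    ... | yes p | yes q | no r  = inj₂ (imp (right (closed m)) p q r)
    check {∇ᶠ A} m with A ∈? w | ∇ᶠ A ∈? v
    ... | no q  | _     = inj₁ λ p → contradiction p q
    ... | yes _ | yes q = inj₁ λ _ → q
    ... | yes p | no q  = inj₂ (dia m p q)
    check {atom _} m = inj₁ _
    check {⊤ᶠ}     m = inj₁ _
    check {⊥ᶠ}     m = inj₁ _
    check {𝟏}      m = inj₁ _
    check {_ ∧ _}  m = inj₁ _
    check {_ ∨ _}  m = inj₁ _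
    check {_ ⊗ _}  m = inj₁ _
  ... | inj₁ acc         = inj₁ acc
  ... | inj₂ (_ , _ , c) = inj₂ c

  -- Once each `∇ᶠ A` with `A ∈ w` is derivable, either kind of conflict derives a formula of `Φ`
  -- missing from `v`, which `k` turns into the goal. Below, these `∇ᶠ A` come from `R→`, `∇r` or
  -- `F`.
  conflict : ∀ {w v} → Conflict w v → (∀ {A} → A ∈ w → Γ ⊢[ L ] ∇ᶠ A) → v ⊑ Γ →
    (∀ {A} → A ∈ Φ → A ∉ v → (A ∷ Γ) ⊢[ L ] C) → Γ ⊢[ L ] C
  conflict (imp m p q r) ds s k = cut₁ (∇-mp (hyp (s q)) (ds p)) (k m r)
  conflict (dia m p q)   ds s k = cut₁ (ds p) (k m q)

  Successor : List World → World → (World → Set) → Set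
  Successor S w P = ∃ λ v → v ∈ S × Acc w v × P v

  Predecessor : List World → World → (World → Set) → Set
  Predecessor S v P = ∃ λ w → w ∈ S × Acc w v × P w

  Saturated : List World → World → Fm → Set
  Saturated S w (atom _) = Unit.⊤
  Saturated S w ⊤ᶠ       = ⊤ᶠ ∈ w
  Saturated S w ⊥ᶠ       = ⊥ᶠ ∉ w
  Saturated S w 𝟏        = 𝟏 ∈ w
  Saturated S w (A ∧ B)  = ((A ∧ B) ∈ w → A ∈ w × B ∈ w) × (A ∈ w × B ∈ w → (A ∧ B) ∈ w)
  Saturated S w (A ∨ B)  = ((A ∨ B) ∈ w → A ∈ w ⊎ B ∈ w) × (A ∈ w ⊎ B ∈ w → (A ∨ B) ∈ w)
  Saturated S w (A ⊗ B)  = ((A ⊗ B) ∈ w → A ∈ w × B ∈ w) × (A ∈ w × B ∈ w → (A ⊗ B) ∈ w)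
  Saturated S w (A ⇒ B)  = (A ⇒ B) ∉ w → Successor S w (λ v → A ∈ v × B ∉ v)
  Saturated S w (∇ᶠ A)   = ∇ᶠ A ∈ w → Predecessor S w (A ∈_)

  FrameCondition : Logic → List World → World → Set
  FrameCondition base   S w = Unit.⊤
  FrameCondition withF  S w = Acc w w
  FrameCondition withwF S w = Successor S w (λ _ → Unit.⊤)

  Good : List World → World → Set
  Good S w = (∀ {A} → A ∈ Φ → Saturated S w A) × FrameCondition L S w

  Complete : List World → Set
  Complete S = ∀ {w} → w ∈ sublists Φ → w ∈ S ⊎ Refuted w

  _both_ : ∀ {P Q : Set} {w} → P ⊎ Refuted w → Q ⊎ Refuted w → (P × Q) ⊎ Refuted w
  inj₁ p both inj₁ q = inj₁ (p , q)
  inj₁ _ both inj₂ r = inj₂ r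
  inj₂ r both _      = inj₂ r

  implies : ∀ {P Q : Set} {w} → Dec P → (P → Q ⊎ Refuted w) → (P → Q) ⊎ Refuted w
  implies (no ¬p) f = inj₁ λ p → contradiction p ¬p
  implies (yes p) f = [ (λ q → inj₁ λ _ → q) , inj₂ ]′ (f p)

  derive : ∀ {w} → A ∈ Φ → w ⊢[ L ] A → A ∈ w ⊎ Refuted w
  derive {A} {w} m d with A ∈? w
  ... | yes p = inj₁ p
  ... | no ¬p = inj₂ (refute d m ¬p)

  module Step (S : List World) (complete : Complete S) where

    -- A failed search also covers deleted worlds, through their refutations, so its outcome ranges
    -- over all of `sublists Φ`, as `cut-sublists` requires.
    search : ∀ {P Q : World → Set} → (∀ v → P v ⊎ Q v) →
      (∃ λ v → v ∈ S × P v) ⊎ (∀ {v} → v ∈ sublists Φ → Refuted v ⊎ Q v)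
    search {P} {Q} dec with all-or-some (sublists Φ) check
      where
      check : ∀ {v} → v ∈ sublists Φ → (Refuted v ⊎ Q v) ⊎ (v ∈ S × P v)
      check {v} m with complete m | dec v
      ... | inj₂ r | _      = inj₁ (inj₁ r)
      ... | inj₁ _ | inj₂ q = inj₁ (inj₂ q)
      ... | inj₁ s | inj₁ p = inj₂ (s , p)
    ... | inj₁ none         = inj₂ none
    ... | inj₂ (v , _ , sp) = inj₁ (v , sp)

    successor : ∀ {w} → A ∈ Φ → B ∈ Φ → (A ⇒ B) ∈ Φ → (A ⇒ B) ∉ w →
      Successor S w (λ v → A ∈ v × B ∉ v) ⊎ Refuted w
    successor {A} {B} {w} a b m ∉w with search dec
      where
      dec : ∀ v → (Acc w v × A ∈ v × B ∉ v) ⊎ (Conflict w v ⊎ A ∉ v ⊎ B ∈ v)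
      dec v with acc-or-conflict w v | A ∈? v | B ∈? v
      ... | inj₂ c | _      | _      = inj₂ (inj₁ c)
      ... | inj₁ _ | no p   | _      = inj₂ (inj₂ (inj₁ p))
      ... | inj₁ _ | yes _  | yes q  = inj₂ (inj₂ (inj₂ q))
      ... | inj₁ r | yes p  | no q   = inj₁ (r , p , q)
    ... | inj₁ found = inj₁ found
    -- Splitting over all `v` proves `B` from `A` and the `∇ᶠ`-image of `w`, so `w` derives `A ⇒ B`,
    -- which it omits.
    ... | inj₂ none  = inj₂ (refute (R→ (cut-sublists Φ entails)) m ∉w)
      where
      entails : ∀ {v} → v ∈ sublists Φ → Entails L Φ v (A ∷ map ∇ᶠ w) B
      entails v∈ Γ C v⊑ s k e with none v∈
      ... | inj₁ r               = r Γ C v⊑ k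
      ... | inj₂ (inj₁ c)        = conflict c (λ p → hyp (s (there (∈-map⁺ ∇ᶠ p)))) v⊑ k
      ... | inj₂ (inj₂ (inj₁ p)) = cut₁ (hyp (s (here refl))) (k a p)
      ... | inj₂ (inj₂ (inj₂ q)) = cut₁ (hyp (v⊑ q)) e

    -- With ⋀ Γ as antecedent, the adjunction turns the goal Γ ⊢ C, given
    -- ∇ A ∈ Γ, into A ⊢ ⋀ Γ ⇒ C, where A can be split over all worlds.
    predecessor : ∀ {v} → A ∈ Φ → ∇ᶠ A ∈ v → Predecessor S v (A ∈_) ⊎ Refuted v
    predecessor {A} {v} a ∇A∈v with search dec
      where
      dec : ∀ w → (Acc w v × A ∈ w) ⊎ (Conflict w v ⊎ A ∉ w)
      dec w with acc-or-conflict w v | A ∈? w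
      ... | inj₂ c | _     = inj₂ (inj₁ c)
      ... | inj₁ _ | no p  = inj₂ (inj₂ p)
      ... | inj₁ r | yes p = inj₁ (r , p)
    ... | inj₁ found = inj₁ found
    ... | inj₂ none  = inj₂ refuted
      where
      refuted : Refuted v
      refuted Γ C v⊑ k =
        ∇-mp (⋀-intro Γ hyp)
          (cut* [ ∇ᶠ A ] (λ { (here refl) → hyp (v⊑ ∇A∈v) }) (∇r (cut-sublists Φ entails)))
        where
        -- `R→` puts `∇ᶠ` before the members of `w`, as `conflict` needs, while `⋀ Γ` on the left
        -- restores the context.
        conflict-⇒ : ∀ {w} → Conflict w v → w ⊢[ L ] (⋀ Γ ⇒ C)
        conflict-⇒ {w} c =
          R→ (cut* (map ∇ᶠ w ++ Γ)
            ([ hyp ∘ there , (λ p → ⋀-elim p (hyp (here refl))) ]′ ∘ ∈-++⁻ (map ∇ᶠ w))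
            (conflict c (hyp ∘ ∈-++⁺ˡ ∘ ∈-map⁺ ∇ᶠ) (∈-++⁺ʳ (map ∇ᶠ w) ∘ v⊑)
              (λ m n → mono (under (∈-++⁺ʳ (map ∇ᶠ w))) (k m n))))

        entails : ∀ {w} → w ∈ sublists Φ → Entails L Φ w [ A ] (⋀ Γ ⇒ C)
        entails w∈ Γ′ C′ w⊑ s k′ e with none w∈
        ... | inj₁ r        = r Γ′ C′ w⊑ k′
        ... | inj₂ (inj₁ c) = cut₁ (mono w⊑ (conflict-⇒ c)) e
        ... | inj₂ (inj₂ p) = cut₁ (hyp (s (here refl))) (k′ a p)

    -- Without a successor, every world is refuted or conflicts with `w`, and `∇ᶠ (⋀ w)` supplies
    -- the needed `∇ᶠ A` by `∇r`. Hence `∇ᶠ (⋀ w)` entails `⊥ᶠ`, and `wF` strips the `∇ᶠ`.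
    serial : L ≡ withwF → ∀ w → Successor S w (λ _ → Unit.⊤) ⊎ Refuted w
    serial isWF w with search dec
      where
      dec : ∀ v → (Acc w v × Unit.⊤) ⊎ Conflict w v
      dec v = [ (λ r → inj₁ (r , _)) , inj₂ ]′ (acc-or-conflict w v)
    ... | inj₁ found = inj₁ found
    ... | inj₂ none  = inj₂ λ Γ C w⊑ _ →
      ⊥-derive (cut* [ ⋀ w ] (λ { (here refl) → ⋀-intro w (hyp ∘ w⊑) })
        (wF isWF (cut-sublists Φ entails)))
      where
      entails : ∀ {v} → v ∈ sublists Φ → Entails L Φ v [ ∇ᶠ (⋀ w) ] ⊥ᶠ
      entails v∈ Γ C v⊑ s k e with none v∈
      ... | inj₁ r = r Γ C v⊑ k
      ... | inj₂ c = conflict c (λ p → mono s (∇r (⋀-elim p ax))) v⊑ k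

    -- By `F` the members of `w` give their own `∇ᶠ`-images, so a conflict of `w` with itself
    -- refutes `w`.
    reflexive : L ≡ withF → ∀ w → Acc w w ⊎ Refuted w
    reflexive isF w with acc-or-conflict w w
    ... | inj₁ r = inj₁ r
    ... | inj₂ c = inj₂ λ Γ C w⊑ k → conflict c (F isF ∘ hyp ∘ w⊑) w⊑ k

    -- The copy `L′` can be split into cases while the module parameter `L` stays fixed.
    frame-condition : ∀ L′ → L ≡ L′ → ∀ w → FrameCondition L′ S w ⊎ Refuted w
    frame-condition base   _ w = inj₁ _
    frame-condition withF  p w = reflexive p w
    frame-condition withwF p w = serial p w

    saturated : ∀ w → A ∈ Φ → Saturated S w A ⊎ Refuted w
    saturated {atom _} w m = inj₁ _
    saturated {⊤ᶠ} w m = derive m top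
    saturated {⊥ᶠ} w m = implies (⊥ᶠ ∈? w) λ p → inj₂ λ Γ C s k → ⊥-derive (hyp (s p))
    saturated {𝟏} w m = derive m (mono (λ ()) one)
    saturated {A ∧ B} w m =
      implies ((A ∧ B) ∈? w) (λ p →
        derive (left (closed m)) (∧-elim₁ (hyp p)) both
        derive (right (closed m)) (∧-elim₂ (hyp p)))
      both
      implies ((A ∈? w) ×-dec (B ∈? w)) (λ (p , q) → derive m (R∧ (hyp p) (hyp q)))
    saturated {A ⊗ B} w m =
      implies ((A ⊗ B) ∈? w) (λ p →
        derive (left (closed m)) (⊗-elim₁ (hyp p)) both
        derive (right (closed m)) (⊗-elim₂ (hyp p)))
      both
      implies ((A ∈? w) ×-dec (B ∈? w)) (λ (p , q) → derive m (⊗-intro (hyp p) (hyp q)))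
    saturated {A ∨ B} w m =
      implies ((A ∨ B) ∈? w) split
      both
      implies ((A ∈? w) ⊎-dec (B ∈? w))
        (derive m ∘ [ R∨₁ ∘ hyp , R∨₂ ∘ hyp ]′)
      where
      split : (A ∨ B) ∈ w → (A ∈ w ⊎ B ∈ w) ⊎ Refuted w
      split p with A ∈? w | B ∈? w
      ... | yes a | _     = inj₁ (inj₁ a)
      ... | no _  | yes b = inj₁ (inj₂ b)
      ... | no a  | no b  = inj₂ λ Γ C s k →
        ∨-elim (hyp (s p)) (k (left (closed m)) a) (k (right (closed m)) b)
    saturated {A ⇒ B} w m =
      implies (¬? ((A ⇒ B) ∈? w)) (successor (left (closed m)) (right (closed m)) m)
    saturated {∇ᶠ A} w m =
      implies (∇ᶠ A ∈? w) (predecessor (closed m (here refl)))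

    good : ∀ w → Good S w ⊎ Refuted w
    good w with all-or-some Φ (saturated w)
    ... | inj₁ sat         = inj₁ sat both frame-condition L refl w
    ... | inj₂ (_ , _ , r) = inj₂ r

  AllGood : List World → Set
  AllGood S = ∀ {w} → w ∈ S → Good S w

  -- Deleting a world can destroy witnesses of others, so all are checked again each time; `n`
  -- bounds the recursion. Completeness survives because the deleted world is refuted.
  eliminate : ∀ n S → length S ≡ n → Complete S → ∃ λ S′ → Complete S′ × AllGood S′
  eliminate n S eq complete with all-or-some S (λ {w} _ → Step.good S complete w)
  ... | inj₁ allGood = S , complete , allGood
  eliminate n S eq complete | inj₂ (w , m , r) with n | delete m
  ... | 0     | S′ , eq′ , _ with ≡-trans (sym eq) eq′
  ...   | ()
  eliminate _ S eq complete | inj₂ (w , m , r) | suc n | S′ , eq′ , keep =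
    eliminate n S′ (ℕ.suc-injective (≡-trans (sym eq′) eq)) complete′
    where
    complete′ : Complete S′
    complete′ v∈ with complete v∈
    ... | inj₂ r′ = inj₂ r′
    ... | inj₁ s with keep s
    ...   | inj₁ refl = inj₂ r
    ...   | inj₂ s′   = inj₁ s′

  countermodel-or-derivation : A ∈ Φ →
    (∃ λ S → AllGood S × ∃ λ w → w ∈ S × A ∉ w) ⊎ ([] ⊢[ L ] A)
  countermodel-or-derivation {A} m with eliminate _ (sublists Φ) refl inj₁
  ... | S , complete , allGood with Step.search S complete decide
    where
    decide : ∀ w → (A ∉ w) ⊎ (A ∈ w)
    decide w with A ∈? w
    ... | yes p = inj₂ p
    ... | no ¬p = inj₁ ¬p
  ...   | inj₁ found = inj₁ (S , allGood , found)
  ...   | inj₂ none  = inj₂ (cut-sublists Φ entails)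
    where
    entails : ∀ {w} → w ∈ sublists Φ → Entails L Φ w [] A
    entails w∈ Γ C w⊑ _ k e with none w∈
    ... | inj₁ r = r Γ C w⊑ k
    ... | inj₂ p = cut₁ (hyp (w⊑ p)) e

-- Embedding finite models into X

-- `Q y x` reads as `x` after `y`: `∇` is the direct image along `Q`, and its implication quantifies
-- over later points.
fromRelation : {X : Set} → (X → X → Set) → Spacetime X
fromRelation Q = record
  { ∇      = λ a x → ∃ λ y → Q y x × a y
  ; ∇-cong = λ (f , g) → (λ x (y , q , p) → y , q , f y p) , (λ x (y , q , p) → y , q , g y p)
  ; ∇-join = λ I f → (λ x (y , q , i , p) → i , y , q , p) , (λ x (i , y , q , p) → y , q , i , p)
  ; _⇛_    = λ a c y → ∀ x → Q y x → a x → c x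
  ; ⇛-adj  = λ a b c → (λ h y p x q r → h x (r , y , q , p)) , (λ h x (r , y , q , p) → h y p x q r)
  }

-- The indicator sequence of the number `toℕ i`; evaluating at `toℕ i` tells it from the others.
Fin↣Cantor : ∀ {n} → Fin n → ℕ → Bool
Fin↣Cantor i n = toℕ i ≡ᵇ n

Fin↣Cantor-injective : ∀ {n} (i j : Fin n) → (∀ k → Fin↣Cantor i k ≡ Fin↣Cantor j k) → i ≡ j
Fin↣Cantor-injective i j eq =
  sym (toℕ-injective (ℕ.≡ᵇ⇒≡ (toℕ j) (toℕ i)
    (subst T (eq (toℕ i)) (ℕ.≡⇒≡ᵇ (toℕ i) (toℕ i) refl))))

module Embedding {X : Set} (ι : (ℕ → Bool) → X) (ι-injective : ∀ α β → ι α ≡ ι β → ∀ n → α n ≡ β n)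
  (L : Logic) (Φ : List Fm) (closed : Closed Φ)
  (S : List (List Fm)) (allGood : Elimination.AllGood L Φ closed S) where

  open Elimination L Φ closed

  -- Positions rather than worlds: a world repeated in `S` gets several points, and `point` stays
  -- injective.
  Index : Set
  Index = Fin (length S)

  world : Index → World
  world = lookup S

  point : Index → X
  point i = ι (Fin↣Cantor i)

  point-injective : ∀ i j → point i ≡ point j → i ≡ j
  point-injective i j eq = Fin↣Cantor-injective i j (ι-injective _ _ eq)

  -- Loops at the points of X outside the model, which (F) and (wF) demand.
  -- Lying in the image of point is undecidable, so under (F) loops go everywhere.
  Loop : Logic → X → Set
  Loop base   x = ⊥
  Loop withF  x = Unit.⊤
  Loop withwF x = ∀ i → x ≢ point i

  Q : X → X → Set
  Q x y = (∃₂ λ i j → x ≡ point i × y ≡ point j × Acc (world i) (world j)) ⊎ (x ≡ y × Loop L x)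

  -- A loop at a point of the model is never a new edge: reflexivity already provides it for
  -- `withF`, and `withwF` puts none there.
  loop-acc : ∀ L′ → (∀ i → FrameCondition L′ S (world i)) → ∀ i → Loop L′ (point i) → Acc (world i) (world i)
  loop-acc withF  cond i _ = cond i
  loop-acc withwF cond i l = contradiction refl (l i)

  good : ∀ i → Good S (world i)
  good i = allGood (∈-lookup i)

  frame : ∀ i → FrameCondition L S (world i)
  frame i = proj₂ (good i)

  -- Together with `Q-to`: no edge of `Q` leaves or enters the image of `point`, so truth there
  -- depends on the finite model alone.
  Q-from : ∀ {i y} → Q (point i) y → ∃ λ j → y ≡ point j × Acc (world i) (world j)
  Q-from {i} (inj₁ (i′ , j , p , q , r)) with point-injective i i′ p
  ... | refl = j , q , r
  Q-from {i} (inj₂ (refl , l)) = i , refl , loop-acc L frame i l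

  Q-to : ∀ {x j} → Q x (point j) → ∃ λ i → x ≡ point i × Acc (world i) (world j)
  Q-to {j = j} (inj₁ (i , j′ , p , q , r)) with point-injective j j′ q
  ... | refl = i , p , r
  Q-to {j = j} (inj₂ (refl , l)) = j , refl , loop-acc L frame j l

  model : Spacetime X
  model = fromRelation Q

  valuation : Valuation X
  valuation n x = ∃ λ i → x ≡ point i × atom n ∈ world i

  index-of : ∀ {w} (P : World → Set) → w ∈ S → P w → ∃ λ i → P (world i)
  index-of P m p = index m , subst P (lookup-index m) p

  inClass : ∀ L′ → L ≡ L′ → InClass L′ model
  inClass base   eq = _
  inClass withF  eq a x p = x , inj₂ (refl , subst (λ l → Loop l x) (sym eq) _) , p
  inClass withwF eq a (∇a⊆∅ , _) = empty , λ _ ()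
    where
    successor : ∀ i → Successor S (world i) (λ _ → Unit.⊤)
    successor i = subst (λ l → FrameCondition l S (world i)) eq (frame i)

    -- If `a` contained a model point, seriality would put a later one into `∇ a`. So every element
    -- of `a` lies outside the model and carries a loop, which puts it into `∇ a` as well.
    outside : ∀ x → a x → ∀ i → x ≢ point i
    outside x p i x≡i with successor i
    ... | v , v∈ , r , _ with index-of (Acc (world i)) v∈ r
    ...   | j , r′ = ∇a⊆∅ (point j) (x , inj₁ (i , j , x≡i , refl , r′) , p)

    empty : a ⊆ ∅
    empty x p = ∇a⊆∅ x (x , inj₂ (refl , subst (λ l → Loop l x) (sym eq) (outside x p)) , p)

  -- For implication from left to right and `∇ᶠ` from right to left, `Acc` suffices; the opposite
  -- directions use the witnesses kept by `Saturated`.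
  truth : ∀ A → A ∈ Φ → ∀ i →
    (A ∈ world i → ⟦ A ⟧ model valuation (point i)) × (⟦ A ⟧ model valuation (point i) → A ∈ world i)
  truth (atom n) m i = (λ p → i , refl , p) , complete
    where
    complete : valuation n (point i) → atom n ∈ world i
    complete (j , eq , p) with point-injective i j eq
    ... | refl = p
  truth ⊤ᶠ m i = _ , λ _ → proj₁ (good i) m
  truth ⊥ᶠ m i = proj₁ (good i) m , λ ()
  truth 𝟏 m i = _ , λ _ → proj₁ (good i) m
  truth (A ∧ B) m i with truth A (left (closed m)) i | truth B (right (closed m)) i | proj₁ (good i) m
  ... | f , f′ | g , g′ | h , h′ = (Product.map f g ∘ h) , (h′ ∘ Product.map f′ g′)
  truth (A ⊗ B) m i with truth A (left (closed m)) i | truth B (right (closed m)) i | proj₁ (good i) m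
  ... | f , f′ | g , g′ | h , h′ = (Product.map f g ∘ h) , (h′ ∘ Product.map f′ g′)
  truth (A ∨ B) m i with truth A (left (closed m)) i | truth B (right (closed m)) i | proj₁ (good i) m
  ... | f , f′ | g , g′ | h , h′ = (Sum.map f g ∘ h) , (h′ ∘ Sum.map f′ g′)
  truth (A ⇒ B) m i = sound , complete
    where
    sound : (A ⇒ B) ∈ world i → ⟦ A ⇒ B ⟧ model valuation (point i)
    sound p x q a with Q-from q
    ... | j , refl , r =
      proj₁ (truth B (right (closed m)) j) (r m p (proj₂ (truth A (left (closed m)) j) a))

    complete : ⟦ A ⇒ B ⟧ model valuation (point i) → (A ⇒ B) ∈ world i
    complete h with (A ⇒ B) ∈? world i
    ... | yes p = p
    ... | no ¬p with proj₁ (good i) m ¬p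
    ...   | v , v∈ , p with index-of (λ v → Acc (world i) v × A ∈ v × B ∉ v) v∈ p
    ...     | j , r , a , ¬b =
      contradiction
        (proj₂ (truth B (right (closed m)) j)
          (h (point j) (inj₁ (i , j , refl , refl , r)) (proj₁ (truth A (left (closed m)) j) a)))
        ¬b
  truth (∇ᶠ A) m i = sound , complete
    where
    sound : ∇ᶠ A ∈ world i → ⟦ ∇ᶠ A ⟧ model valuation (point i)
    sound p with proj₁ (good i) m p
    ... | w , w∈ , q with index-of (λ w → Acc w (world i) × A ∈ w) w∈ q
    ...   | j , r , a =
      point j , inj₁ (j , i , refl , refl , r) , proj₁ (truth A (closed m (here refl)) j) a

    complete : ⟦ ∇ᶠ A ⟧ model valuation (point i) → ∇ᶠ A ∈ world i
    complete (y , q , a) with Q-to q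
    ... | j , refl , r = r m (proj₂ (truth A (closed m (here refl)) j) a)

-- Completeness

completeness : {X : Set} → AtLeastContinuum X → ∀ L A → X ⊨[ L ] A → [] ⊢[ L ] A
completeness (ι , ι-injective) L A valid
  with Elimination.countermodel-or-derivation L (subs A) (subs-closed A) (here refl)
... | inj₂ d = d
... | inj₁ (S , allGood , w , w∈ , A∉w) with Embedding.index-of ι ι-injective L _ _ S allGood (A ∉_) w∈ A∉w
...   | i , A∉i = contradiction (proj₂ (truth A (here refl) i) (valid model (inClass L refl) valuation (point i) _)) A∉i
  where open Embedding ι ι-injective L (subs A) (subs-closed A) S allGood

theorem8p11 : (X : Set) → AtLeastContinuum X → ∀ (A : Fm) →
    ((X ⊨[ base ] A → [] ⊢[ base ] A) ×
    (X ⊨[ withF ] A → [] ⊢[ withF ] A) ×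
    (X ⊨[ withwF ] A → [] ⊢[ withwF ] A))
theorem8p11 X c A = completeness c base A , completeness c withF A , completeness c withwF A
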